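{- Let $n\ge 1$ and $0\le k\le n-1$. Let $\mathcal{P}(n+k-1,k)$ be the set of partial matchings of $[n+k-1]$ with exactly $k$ arcs that contain no $2$-right crossings and no right nestings. Let $\mathcal{S}(n,k)$ be the set of integer sequences $x=x_0x_1\ldots x_{n-1}$ with exactly $n-k$ left-to-right maxima such that (1) $x_0=0$; (2) for all $1\le i\le n-1$, $0\le x_i\le \max(x_0,x_1,\ldots,x_{i-1})+1$; (3) for all $1\le i\le n-1$, if $0\le x_i<\max(x_0,x_1,\ldots,x_{i-1})$, then $x_i<x_{i-1}$. Then there exists a bijection between $\mathcal{P}(n+k-1,k)$ and $\mathcal{S}(n,k)$.
   Context: $[m]=\{1,2,\ldots,m\}$, with $[0]=\emptyset$ (which has exactly one partition, the empty one). A partial matching of $[m]$ is a set partition of $[m]$ in which every block has at most two elements; each two-element block $\{i,j\}$ with $i<j$ is called an arc and written $(i,j)$. A right nesting is a pair of arcs $(i_1,j_1)$, $(i_2,j_2)$ with $i_1<i_2<j_2<j_1$ and $j_1=j_2+1$. A $2$-right crossing is a pair of arcs $(i_1,j_1)$, $(i_2,j_2)$ with $i_1<i_2<j_1<j_2$ and $j_2-j_1\le 2$. An entry $x_i$ of a sequence $x_0x_1\ldots x_{n-1}$ is a left-to-right maximum if it is strictly greater than all entries preceding it; the first entry $x_0$ is always counted as a left-to-right maximum. -}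

module Defs where

open import Data.Fin.Base as Fin using (Fin; toℕ)
import Data.Fin.Properties as Fin
open import Data.Fin.Subset using (Subset; ⁅_⁆; _∪_; _∩_; ⋃; ⊤; ∣_∣; Nonempty; Empty)
open import Data.Integer.Base as ℤ using (ℤ; 0ℤ; 1ℤ)
import Data.Integer.Properties as ℤ
open import Data.List.Base using (List; []; _∷_; length; filter; take; allFin)
open import Data.List.Extrema ℤ.≤-totalOrder using (max)
open import Data.List.Membership.Propositional using (_∈_)
open import Data.List.Relation.Binary.BagAndSetEquality using ([_]-Equality; set)
open import Data.List.Relation.Unary.All using (All)
open import Data.List.Relation.Unary.AllPairs using (AllPairs)
open import Data.Nat.Base using (ℕ; _+_; _∸_; _≤_)
import Data.Nat.Properties as ℕ
open import Data.Product.Base using (_×_; ∃-syntax)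
open import Data.Vec.Base using (Vec; lookup; toList)
open import Level using (0ℓ)
open import Relation.Binary.Bundles using (Setoid)
import Relation.Binary.Construct.On as On
open import Relation.Binary.PropositionalEquality using (_≡_; setoid)
open import Relation.Nullary.Decidable using (Dec; _→-dec_)
open import Relation.Nullary.Negation using (¬_)

-- The element e of {1,…,m} is represented by the index e - 1 of Fin m; only
-- comparisons and differences of elements are used below.  The order in which
-- `blocks` lists the blocks is irrelevant: see `𝒫`.
record SetPartition (m : ℕ) : Set where
  field
    blocks   : List (Subset m)
    nonempty : All Nonempty blocks
    disjoint : AllPairs (λ B C → Empty (B ∩ C)) blocks
    covering : ⋃ blocks ≡ ⊤

open SetPartition public

module _ {m : ℕ} (π : SetPartition m) where

  IsPartialMatching : Set
  IsPartialMatching = All (λ B → ∣ B ∣ ≤ 2) (blocks π)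

  IsArc : Fin m → Fin m → Set
  IsArc i j = i Fin.< j × (⁅ i ⁆ ∪ ⁅ j ⁆) ∈ blocks π

  -- The listed blocks are pairwise distinct, being nonempty and disjoint, so
  -- this counts each arc once.
  numArcs : ℕ
  numArcs = length (filter (λ B → ∣ B ∣ ℕ.≟ 2) (blocks π))

  HasRightNesting : Set
  HasRightNesting =
    ∃[ i₁ ] ∃[ j₁ ] ∃[ i₂ ] ∃[ j₂ ]
      IsArc i₁ j₁ × IsArc i₂ j₂ ×
      i₁ Fin.< i₂ × i₂ Fin.< j₂ × j₂ Fin.< j₁ ×
      toℕ j₁ ≡ toℕ j₂ + 1

  -- Truncated subtraction is exact here, as j₁ < j₂.
  HasRightCrossing : ℕ → Set
  HasRightCrossing d =
    ∃[ i₁ ] ∃[ j₁ ] ∃[ i₂ ] ∃[ j₂ ]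
      IsArc i₁ j₁ × IsArc i₂ j₂ ×
      i₁ Fin.< i₂ × i₂ Fin.< j₁ × j₁ Fin.< j₂ ×
      toℕ j₂ ∸ toℕ j₁ ≤ d

record RestrictedMatching (m k : ℕ) : Set where
  field
    partition          : SetPartition m
    isPartialMatching  : IsPartialMatching partition
    numArcs≡k          : numArcs partition ≡ k
    no-2-rightCrossing : ¬ HasRightCrossing partition 2
    no-rightNesting    : ¬ HasRightNesting partition

-- Two partitions are equal when they have the same set of blocks.
𝒫 : ℕ → ℕ → Setoid 0ℓ 0ℓ
𝒫 m k = On.setoid ([ set ]-Equality (Subset m))
                  (λ (M : RestrictedMatching m k) → blocks (RestrictedMatching.partition M))

-- The value on [] is junk: `maximum` is only applied to nonempty lists.
maximum : List ℤ → ℤ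
maximum []       = 0ℤ
maximum (y ∷ ys) = max y ys

module _ {n : ℕ} (x : Vec ℤ n) where

  IsLTRMax : Fin n → Set
  IsLTRMax i = ∀ j → j Fin.< i → lookup x j ℤ.< lookup x i

  isLTRMax? : ∀ i → Dec (IsLTRMax i)
  isLTRMax? i = Fin.all? λ j → (j Fin.<? i) →-dec (lookup x j ℤ.<? lookup x i)

  numLTRMax : ℕ
  numLTRMax = length (filter isLTRMax? (allFin n))

  -- max(x₀,…,xᵢ₋₁), for i ≥ 1
  maxBefore : Fin n → ℤ
  maxBefore i = maximum (take (toℕ i) (toList x))

-- For i ≥ 1, `Fin.pred i` is the index i - 1.
record RestrictedSequence (n k : ℕ) : Set where
  field
    seq         : Vec ℤ n
    numLTRMax≡  : numLTRMax seq ≡ n ∸ k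
    startsAt0   : ∀ i → toℕ i ≡ 0 → lookup seq i ≡ 0ℤ
    growth      : ∀ i → 1 ≤ toℕ i →
                  0ℤ ℤ.≤ lookup seq i × lookup seq i ℤ.≤ maxBefore seq i ℤ.+ 1ℤ
    descent     : ∀ i → 1 ≤ toℕ i →
                  0ℤ ℤ.≤ lookup seq i → lookup seq i ℤ.< maxBefore seq i →
                  lookup seq i ℤ.< lookup seq (Fin.pred i)

-- Two elements are equal when the underlying sequences are.
𝒮 : ℕ → ℕ → Setoid 0ℓ 0ℓ
𝒮 n k = On.setoid (setoid (Vec ℤ n)) (RestrictedSequence.seq {n} {k})

{-# OPTIONS --safe #-}

-- Without right nestings and 2-right crossings no two closers are adjacent, so
-- that [n+k-1] splits into n-1 units, each a non-closer X or a pair XC of a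
-- non-closer and the closer following it.  Read the units from left to right,
-- and record for XC the number of unmatched non-closers to the left of the one
-- that C is matched to, and for X the number of all unmatched non-closers, X
-- included.  With x₀ = 0 in front, these numbers are the sequence: a unit X
-- makes a new maximum, the maximum is the number of X units so far, and a closer
-- matched to the X of its own unit repeats the maximum.  In two consecutive
-- units XC X'C' either C' is matched to X', or the crossing C, C' at distance 2
-- must be avoided, which says that the recorded number decreases.

module Submission where

open import Defs
import Data.Bool.Properties as Bool
open import Data.Fin.Base as Fin using (Fin; toℕ; fromℕ<; inject₁)
import Data.Fin.Properties as Fin
open import Data.Fin.Subset as Subset
  using (Subset; inside; outside; ⊥; ⊤; ⁅_⁆; _∪_; _∩_; ⋃; ∣_∣; Nonempty; Empty)
import Data.Fin.Subset.Properties as Subset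
open import Data.Integer.Base as ℤ using (ℤ; +_; -[1+_]; 0ℤ; 1ℤ; +≤+; +<+)
import Data.Integer.Properties as ℤ
open import Data.List.Base
  using (List; []; _∷_; _++_; _ʳ++_; length; map; filter; take; allFin; tabulate)
open import Data.List.Extrema ℤ.≤-totalOrder using (max; max≤v⁺; max<v⁺; ⊥≤max; xs≤max)
import Data.List.Membership.DecPropositional as DecMembership
open import Data.List.Membership.Propositional using (_∈_; find)
open import Data.List.Membership.Propositional.Properties
  using (∈-map⁺; ∈-map⁻; ∈-++⁺ˡ; ∈-++⁺ʳ; ∈-++⁻; ∈-filter⁺; ∈-filter⁻)
open import Data.List.Membership.Propositional.Properties.WithK using (unique∧set⇒bag)
import Data.List.Properties as List
open import Data.List.Relation.Binary.BagAndSetEquality using (∼bag⇒↭)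
open import Data.List.Relation.Binary.Permutation.Propositional.Properties using (↭-length)
open import Data.List.Relation.Unary.All as All using (All; []; _∷_)
import Data.List.Relation.Unary.All.Properties as All
open import Data.List.Relation.Unary.AllPairs as AllPairs using (AllPairs; []; _∷_)
import Data.List.Relation.Unary.AllPairs.Properties as AllPairs
open import Data.List.Relation.Unary.Any using (Any; here; there)
open import Data.List.Relation.Unary.Unique.Propositional using (Unique)
import Data.List.Relation.Unary.Unique.Propositional.Properties as Unique
open import Data.Nat.Base using (ℕ; zero; suc; _+_; _∸_; _≤_; _<_; _>_; z≤n; s≤s)
import Data.Nat.Properties as ℕ
open import Data.Product.Base as Product using (_×_; _,_; proj₁; proj₂; ∃; ∃₂; ∃-syntax)
open import Data.Sum.Base as Sum using (_⊎_; inj₁; inj₂; [_,_]′)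
open import Data.Vec.Base as Vec using (Vec; []; _∷_; here; there; lookup; toList)
import Data.Vec.Properties as Vec
open import Function.Base using (_∘_; _on_; id)
open import Function.Bundles using (Bijection; Equivalence; mk⇔)
open import Level using (0ℓ)
open import Relation.Binary.Bundles using (Setoid)
open import Relation.Binary.Definitions using (DecidableEquality; Symmetric; tri<; tri≈; tri>)
open import Relation.Binary.PropositionalEquality
  using (_≡_; _≢_; refl; sym; trans; cong; cong₂; subst; module ≡-Reasoning)
open import Relation.Nullary.Decidable using (Dec; yes; no; map′; _×-dec_)
open import Relation.Nullary.Negation using (¬_; contradiction)
open import Relation.Unary using (Decidable; Pred; _≐_)

-- Matchings and their codes

-- `Pick i L L′ r`: removing i from L leaves L′, and r entries of L follow i.
data Pick (i : ℕ) : List ℕ → List ℕ → ℕ → Set where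
  here  : ∀ {L} → Pick i (i ∷ L) L (length L)
  there : ∀ {a L L′ r} → Pick i L L′ r → Pick i (a ∷ L) (a ∷ L′) r

Pick⇒∈ : ∀ {i L L′ r} → Pick i L L′ r → i ∈ L
Pick⇒∈ here      = here refl
Pick⇒∈ (there p) = there (Pick⇒∈ p)

∈⇒Pick : ∀ {i L} → i ∈ L → ∃₂ (Pick i L)
∈⇒Pick (here refl) = _ , _ , here
∈⇒Pick (there i∈L) with _ , _ , p ← ∈⇒Pick i∈L = _ , _ , there p

Pick-rest⊆ : ∀ {i L L′ r q} → Pick i L L′ r → q ∈ L′ → q ∈ L
Pick-rest⊆ here      q∈         = there q∈
Pick-rest⊆ (there p) (here q≡)  = here q≡
Pick-rest⊆ (there p) (there q∈) = there (Pick-rest⊆ p q∈)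

Pick-cover : ∀ {i L L′ r q} → Pick i L L′ r → q ∈ L → q ≡ i ⊎ q ∈ L′
Pick-cover here      (here q≡)  = inj₁ q≡
Pick-cover here      (there q∈) = inj₂ q∈
Pick-cover (there p) (here q≡)  = inj₂ (here q≡)
Pick-cover (there p) (there q∈) = Sum.map₂ there (Pick-cover p q∈)

Pick-length : ∀ {i L L′ r} → Pick i L L′ r → length L ≡ suc (length L′)
Pick-length here      = refl
Pick-length (there p) = cong suc (Pick-length p)

Pick-rank< : ∀ {i L L′ r} → Pick i L L′ r → r < length L
Pick-rank< here      = ℕ.≤-refl
Pick-rank< (there p) = ℕ.m<n⇒m<1+n (Pick-rank< p)

pick-rank : ∀ {r} L → r < length L → ∃₂ λ i L′ → Pick i L L′ r
pick-rank {r} (a ∷ L) r<1+L with r ℕ.≟ length L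
... | yes refl = _ , _ , here
... | no  r≢L
  with _ , _ , p ← pick-rank L (ℕ.≤∧≢⇒< (ℕ.≤-pred r<1+L) r≢L) = _ , _ , there p

Pick-All : ∀ {i L L′ r} {P : ℕ → Set} → Pick i L L′ r → All P L → All P L′
Pick-All p Ps = All.tabulate (All.lookup Ps ∘ Pick-rest⊆ p)

Pick-AllPairs : ∀ {i L L′ r} {R : ℕ → ℕ → Set} →
                Pick i L L′ r → AllPairs R L → AllPairs R L′
Pick-AllPairs here      (_ ∷ Rs)  = Rs
Pick-AllPairs (there p) (Rx ∷ Rs) = Pick-All p Rx ∷ Pick-AllPairs p Rs

Decreasing : List ℕ → Set
Decreasing = AllPairs _>_

Pick-removes : ∀ {i L L′ r} → Decreasing L → Pick i L L′ r → ¬ i ∈ L′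
Pick-removes (>L ∷ _)   here      i∈         = ℕ.<-irrefl refl (All.lookup >L i∈)
Pick-removes (>L ∷ _)   (there p) (here refl) = ℕ.<-irrefl refl (All.lookup >L (Pick⇒∈ p))
Pick-removes (_ ∷ dec) (there p) (there i∈) = Pick-removes dec p i∈

-- A rank counts the entries behind i and so fixes the position, whatever the order of `L`. Thus a
-- letter of the code determines an opener.
Pick-rank-injective : ∀ {i j L L′ L″ r} → Pick i L L′ r → Pick j L L″ r →
                      i ≡ j × L′ ≡ L″
Pick-rank-injective here      here      = refl , refl
Pick-rank-injective here      (there q) = contradiction (Pick-rank< q) (ℕ.<-irrefl refl)
Pick-rank-injective (there p) here      = contradiction (Pick-rank< p) (ℕ.<-irrefl refl)
Pick-rank-injective (there p) (there q) =
  Product.map₂ (cong (_ ∷_)) (Pick-rank-injective p q)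

-- A decreasing list has no repetitions, so i has only one position. Thus an opener determines a
-- letter of the code.
Pick-functional : ∀ {i L L′ L″ r s} → Decreasing L → Pick i L L′ r → Pick i L L″ s →
                  r ≡ s × L′ ≡ L″
Pick-functional _        here      here      = refl , refl
Pick-functional (>L ∷ _) here      (there q) =
  contradiction (All.lookup >L (Pick⇒∈ q)) (ℕ.<-irrefl refl)
Pick-functional (>L ∷ _) (there p) here      =
  contradiction (All.lookup >L (Pick⇒∈ p)) (ℕ.<-irrefl refl)
Pick-functional (_ ∷ dec) (there p) (there q) =
  Product.map₂ (cong (_ ∷_)) (Pick-functional dec p q)

-- The r entries behind i end both `L` and `L′`. A rank below r in `L′` therefore means a position
-- behind i in `L`, where all entries are smaller.
Pick²-rank⇒< : ∀ {i j L L′ L″ r s} → Decreasing L → Pick i L L′ r → Pick j L′ L″ s →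
               s < r → j < i
Pick²-rank⇒< (>L ∷ _)  here      q         s<r = All.lookup >L (Pick⇒∈ q)
Pick²-rank⇒< _         (there p) here      s<r =
  contradiction (subst (_ <_) (Pick-length p) (Pick-rank< p)) (ℕ.≤⇒≯ s<r)
Pick²-rank⇒< (_ ∷ dec) (there p) (there q) s<r = Pick²-rank⇒< dec p q s<r

Pick²-<⇒rank : ∀ {i j L L′ L″ r s} → Decreasing L → Pick i L L′ r → Pick j L′ L″ s →
               j < i → s < r
Pick²-<⇒rank _         here      q         j<i = Pick-rank< q
Pick²-<⇒rank (>L ∷ _)  (there p) here      j<i =
  contradiction j<i (ℕ.<⇒≯ (All.lookup >L (Pick⇒∈ p)))
Pick²-<⇒rank (_ ∷ dec) (there p) (there q) j<i = Pick²-<⇒rank dec p q j<i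

-- Scans of matchings

Arcs : Set
Arcs = List (ℕ × ℕ)

-- `Scan c m av as`: the matching of {0,…,m-1} with arcs `as` and singletons
-- `av`, listed in decreasing order, has the code c, listed last letter first.
data Scan : List ℕ → ℕ → List ℕ → Arcs → Set where
  start : Scan (0 ∷ []) 0 [] []
  skip  : ∀ {c m av as} → Scan c m av as →
          Scan (suc (length av) ∷ c) (suc m) (m ∷ av) as
  close : ∀ {p c m av av′ as i r} → Scan (p ∷ c) m av as →
          Pick i (m ∷ av) av′ r → r ≡ length av ⊎ r < p →
          Scan (r ∷ p ∷ c) (suc (suc m)) av′ ((i , suc m) ∷ as)

private variable
  c c′ av av′ : List ℕ
  m m′ : ℕ
  as as′ : Arcs

-- The next point m is included because `close` picks its opener from `m ∷ av`.
decreasing : Scan c m av as → Decreasing (m ∷ av)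
decreasing start         = [] ∷ []
decreasing (skip s)      with >av ∷ dec ← decreasing s =
  (ℕ.≤-refl ∷ All.map ℕ.m<n⇒m<1+n >av) ∷ >av ∷ dec
decreasing (close s p _) with >av ∷ dec ← decreasing s =
  Pick-All p (ℕ.m<n⇒m<1+n ℕ.≤-refl ∷ All.map (ℕ.m<n⇒m<1+n ∘ ℕ.m<n⇒m<1+n) >av)
  ∷ Pick-AllPairs p (>av ∷ dec)

av< : Scan c m av as → ∀ {q} → q ∈ av → q < m
av< s with >av ∷ _ ← decreasing s = All.lookup >av

Pick≤ : ∀ {i r} → Scan c m av as → Pick i (m ∷ av) av′ r → i ≤ m
Pick≤ s p with Pick⇒∈ p
... | here refl = ℕ.≤-refl
... | there i∈  = ℕ.<⇒≤ (av< s i∈)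

bounded : Scan c m av as → ∀ {i j} → (i , j) ∈ as → i < j × j < m
bounded (skip s)      a∈          = Product.map₂ ℕ.m<n⇒m<1+n (bounded s a∈)
bounded (close s p _) (here refl) = s≤s (Pick≤ s p) , ℕ.≤-refl
bounded (close s p _) (there a∈)  =
  Product.map₂ (ℕ.m<n⇒m<1+n ∘ ℕ.m<n⇒m<1+n) (bounded s a∈)

Touches : ℕ → ℕ × ℕ → Set
Touches q (i , j) = q ≡ i ⊎ q ≡ j

cover : Scan c m av as → ∀ {q} → q < m → q ∈ av ⊎ Any (Touches q) as
cover start ()
cover (skip {m = m} s) {q} q<1+m with q ℕ.≟ m
... | yes refl = inj₁ (here refl)
... | no q≢m   = Sum.map₁ there (cover s (ℕ.≤∧≢⇒< (ℕ.≤-pred q<1+m) q≢m))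
cover (close {m = m} s p _) {q} q<2+m with q ℕ.≟ suc m | q ℕ.≟ m
... | yes refl | _        = inj₂ (here (inj₂ refl))
... | no _     | yes refl = [ (λ q≡i → inj₂ (here (inj₁ q≡i))) , inj₁ ]′ (Pick-cover p (here refl))
... | no q≢1+m | no q≢m   =
  [ [ (λ q≡i → inj₂ (here (inj₁ q≡i))) , inj₁ ]′ ∘ Pick-cover p ∘ there , inj₂ ∘ there ]′
    (cover s (ℕ.≤∧≢⇒< (ℕ.≤-pred (ℕ.≤∧≢⇒< (ℕ.≤-pred q<2+m) q≢1+m)) q≢m))

untouched : Scan c m av as → ∀ {q a} → q ∈ av → a ∈ as → ¬ Touches q a
untouched (skip s) (here refl) a∈ (inj₁ refl) with i<j , j<m ← bounded s a∈ =
  ℕ.<-asym i<j j<m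
untouched (skip s) (here refl) a∈ (inj₂ refl) = ℕ.<-irrefl refl (proj₂ (bounded s a∈))
untouched (skip s) (there q∈)  a∈ t           = untouched s q∈ a∈ t
untouched (close s p _) q∈ (here refl) (inj₁ refl) = Pick-removes (decreasing s) p q∈
untouched (close s p _) q∈ (here refl) (inj₂ refl) with Pick-rest⊆ p q∈
... | there 1+m∈ = ℕ.<-asym (ℕ.n<1+n _) (av< s 1+m∈)
untouched (close s p _) q∈ (there a∈)  t           with Pick-rest⊆ p q∈
... | there q∈av = untouched s q∈av a∈ t
... | here refl  with i<j , j<m ← bounded s a∈ | t
...   | inj₁ refl = ℕ.<-asym i<j j<m
...   | inj₂ refl = ℕ.<-irrefl refl j<m

Apart : ℕ × ℕ → ℕ × ℕ → Set
Apart a b = ∀ {q} → Touches q a → ¬ Touches q b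

apart : Scan c m av as → AllPairs Apart as
apart start         = []
apart (skip s)      = apart s
apart (close {m = m} s p _) = All.tabulate new-apart ∷ apart s
  where
  new-apart : ∀ {a} → a ∈ _ → Apart (_ , suc m) a
  new-apart a∈ (inj₁ refl) t with Pick⇒∈ p
  ... | here refl = untouched (skip s) (here refl) a∈ t
  ... | there q∈  = untouched s q∈ a∈ t
  new-apart a∈ (inj₂ refl) (inj₁ refl) with i<j , j<m ← bounded s a∈ =
    ℕ.<-asym (ℕ.<-trans i<j j<m) (ℕ.n<1+n m)
  new-apart a∈ (inj₂ refl) (inj₂ refl) =
    ℕ.<-asym (proj₂ (bounded s a∈)) (ℕ.n<1+n m)

-- Each closer `suc m` is preceded by the non-closer m of its own unit. This rules out right
-- nestings, whose closers are adjacent.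
no-adjacent-closers : Scan c m av as → ∀ {i i′ j} → (i , j) ∈ as → ¬ (i′ , suc j) ∈ as
no-adjacent-closers (skip s)      a∈          b∈          = no-adjacent-closers s a∈ b∈
no-adjacent-closers (close s _ _) (here refl) (there b∈)  =
  ℕ.<-irrefl refl (ℕ.<-trans (proj₂ (bounded s b∈)) (ℕ.m<n⇒m<1+n ℕ.≤-refl))
no-adjacent-closers (close s _ _) (there a∈)  (here refl) =
  ℕ.<-irrefl refl (proj₂ (bounded s a∈))
no-adjacent-closers (close s _ _) (there a∈)  (there b∈)  = no-adjacent-closers s a∈ b∈

-- An arc ending at the last point m-1 was closed with rank p, so that a rank
-- below p belongs to an opener left of it.
last-closer : ∀ {p i r i′ m′} → Scan (p ∷ c) (suc m′) av as → (i′ , m′) ∈ as →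
              Pick i av av′ r → r < p → i < i′
last-closer (skip s) a∈ _ _ = contradiction (proj₂ (bounded s a∈)) (ℕ.<-irrefl refl)
last-closer (close s p _) (here refl) q r<p = Pick²-rank⇒< (decreasing s) p q r<p
last-closer (close s _ _) (there a∈)  _ _   =
  contradiction (proj₂ (bounded s a∈)) (ℕ.<-asym (ℕ.n<1+n _))

-- Converse of `last-closer`. After `skip`, p is the length of `av` and exceeds every rank in it;
-- after `close`, the order of the two openers decides.
last-closer⁻ : ∀ {p i r} → Scan (p ∷ c) m av as → Pick i av av′ r →
               (∀ {i′ m′} → m ≡ suc m′ → (i′ , m′) ∈ as → i < i′) → r < p
last-closer⁻ (skip s)      q _ = Pick-rank< q
last-closer⁻ (close s p _) q h = Pick²-<⇒rank (decreasing s) p q (h refl (here refl))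

j<m∧1+m∸j≤2⇒m≡1+j : ∀ {j m} → j < m → suc m ∸ j ≤ 2 → m ≡ suc j
j<m∧1+m∸j≤2⇒m≡1+j {j} {m} j<m d≤2 = ℕ.≤-antisym
  (ℕ.≤-pred (ℕ.≤-trans (ℕ.m≤n+m∸n (suc m) j)
    (ℕ.≤-trans (ℕ.+-monoʳ-≤ j d≤2) (ℕ.≤-reflexive (ℕ.+-comm j 2))))) j<m

-- The critical pair consists of the newest arc, which ends at `suc m`, and an earlier one. At
-- distance at most 2 the earlier arc ends at m - 1, in the unit just before.
no-2-crossing : Scan c m av as → ∀ {i i′ j j′} → (i , j) ∈ as → (i′ , j′) ∈ as →
                i < i′ → i′ < j → j < j′ → ¬ j′ ∸ j ≤ 2
no-2-crossing (skip s) a∈ b∈ = no-2-crossing s a∈ b∈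
no-2-crossing (close s _ _) (here refl) (here refl) _ _ j<j′ _ = ℕ.<-irrefl refl j<j′
no-2-crossing (close s _ _) (here refl) (there b∈) _ _ j<j′ _ =
  ℕ.<-asym (ℕ.<-trans (ℕ.n<1+n _) j<j′) (proj₂ (bounded s b∈))
no-2-crossing (close s _ _) (there a∈) (there b∈) = no-2-crossing s a∈ b∈
no-2-crossing (close {m = m} s p r≡∨<) {j = j} (there a∈) (here refl) i<i′ i′<j j<j′ d≤2
  with refl ← j<m∧1+m∸j≤2⇒m≡1+j (proj₂ (bounded s a∈)) d≤2 | p
... | here    = ℕ.<-asym i′<j (ℕ.n<1+n j)
-- Here the newest opener lies in `av`, so its rank is below `length av`. This leaves r < p, which
-- puts it left of the earlier opener: a nesting instead of a crossing.
... | there q with r≡∨<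
...   | inj₁ refl = ℕ.<-irrefl refl (Pick-rank< q)
...   | inj₂ r<p  = ℕ.<-asym i<i′ (last-closer s a∈ q r<p)

drop-new : ∀ {i} → Scan c m av as →
       (∀ {a} → a ∈ as → a ∈ (i , suc m) ∷ as′) → ∀ {a} → a ∈ as → a ∈ as′
drop-new s h a∈ with h a∈
... | there a∈′ = a∈′
... | here refl = contradiction (proj₂ (bounded s a∈)) (ℕ.<-asym (ℕ.n<1+n _))

-- The last unit is XC exactly if an arc ends at the last point. By induction both scans pick the
-- opener of that arc from the same list, hence with the same rank.
arcs⇒code : Scan c m av as → Scan c′ m av′ as′ →
            (∀ {a} → a ∈ as → a ∈ as′) → (∀ {a} → a ∈ as′ → a ∈ as) →
            c ≡ c′ × av ≡ av′
arcs⇒code start start _ _ = refl , refl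
arcs⇒code (skip s) (skip s′) f g with refl , refl ← arcs⇒code s s′ f g = refl , refl
arcs⇒code (skip s) (close s′ _ _) f g =
  contradiction (proj₂ (bounded s (g (here refl)))) (ℕ.<-irrefl refl)
arcs⇒code (close s _ _) (skip s′) f g =
  contradiction (proj₂ (bounded s′ (f (here refl)))) (ℕ.<-irrefl refl)
arcs⇒code (close s p _) (close s′ p′ _) f g
  with refl , refl ← arcs⇒code s s′ (drop-new s (f ∘ there)) (drop-new s′ (g ∘ there))
     | f (here refl)
... | there a∈  = contradiction (proj₂ (bounded s′ a∈)) (ℕ.<-asym (ℕ.n<1+n _))
... | here refl with refl , refl ← Pick-functional (decreasing s) p p′ = refl , refl

-- The last letter reveals the kind of the last unit: `skip` writes one more than the length of
-- `av`, `close` a rank of at most that length.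
code⇒arcs : Scan c m av as → Scan c′ m′ av′ as′ → c ≡ c′ →
            m ≡ m′ × av ≡ av′ × as ≡ as′
code⇒arcs start start _ = refl , refl , refl
code⇒arcs start (skip _) ()
code⇒arcs start (close _ _ _) ()
code⇒arcs (skip _) start ()
code⇒arcs (close _ _ _) start ()
code⇒arcs (skip s) (skip s′) eq
  with refl , refl , refl ← code⇒arcs s s′ (List.∷-injectiveʳ eq) = refl , refl , refl
code⇒arcs (skip s) (close s′ p _) eq
  with refl , refl , refl ← code⇒arcs s s′ (List.∷-injectiveʳ eq) =
  contradiction (Pick-rank< p) (ℕ.<-irrefl (sym (List.∷-injectiveˡ eq)))
code⇒arcs (close s p _) (skip s′) eq
  with refl , refl , refl ← code⇒arcs s s′ (List.∷-injectiveʳ eq) =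
  contradiction (Pick-rank< p) (ℕ.<-irrefl (List.∷-injectiveˡ eq))
code⇒arcs (close s p _) (close s′ p′ _) eq
  with refl , refl , refl ← code⇒arcs s s′ (List.∷-injectiveʳ eq)
  with refl ← List.∷-injectiveˡ eq
  with refl , refl ← Pick-rank-injective p p′ = refl , refl , refl

scan-size : Scan c m av as → m ≡ length as + length as + length av
scan-size start = refl
scan-size (skip {av = av} s) = trans (cong suc (scan-size s)) (sym (ℕ.+-suc _ (length av)))
scan-size (close {as = as} s p _)
  rewrite scan-size s | ℕ.+-suc (length as) (length as)
        | sym (ℕ.suc-injective (Pick-length p)) = refl

-- A unit X lengthens `av`; a unit XC lengthens `as` and keeps the length of `av`. The `suc` stands
-- for the initial letter 0.
code-length : Scan c m av as → length c ≡ suc (length as + length av)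
code-length start = refl
code-length (skip {av = av} {as = as} s) =
  cong suc (trans (code-length s) (sym (ℕ.+-suc (length as) (length av))))
code-length (close {as = as} s p _) =
  cong suc (trans (code-length s)
    (cong (λ l → suc (length as + l)) (ℕ.suc-injective (Pick-length p))))

-- `Word M p zs k`: zs may follow a prefix with maximum M and last letter p, and
-- exactly k letters of zs do not exceed all their predecessors.
data Word (M p : ℕ) : List ℕ → ℕ → Set where
  []  : Word M p [] 0
  new : ∀ {zs k} → Word (suc M) (suc M) zs k → Word M p (suc M ∷ zs) k
  old : ∀ {x zs k} → x ≤ M → x ≡ M ⊎ x < p → Word M x zs k → Word M p (x ∷ zs) (suc k)

-- The maximum of the word stays equal to `length av`: `skip` raises both by one, `close` keeps
-- both. Hence a letter x ≤ M is always the rank of some entry of `m ∷ av`.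
Word⇒Scan : ∀ {p zs k} → Scan (p ∷ c) m av as → Word (length av) p zs k →
            ∃[ m′ ] ∃₂ λ av′ as′ →
              Scan (zs ʳ++ p ∷ c) m′ av′ as′ × length as′ ≡ k + length as
Word⇒Scan s [] = _ , _ , _ , s , refl
Word⇒Scan s (new w) = Word⇒Scan (skip s) w
Word⇒Scan {m = m} {av} {as} s (old {k = k} x≤M x≡M∨x<p w)
  with i , av′ , p ← pick-rank (m ∷ av) (s≤s x≤M)
  with m″ , av″ , as″ , s″ , eq ← Word⇒Scan (close s p x≡M∨x<p)
         (subst (λ l → Word l _ _ _) (ℕ.suc-injective (Pick-length p)) w) =
  m″ , av″ , as″ , s″ , trans eq (ℕ.+-suc k (length as))

-- The scan is undone from its last letter on, and zs collects the letters already removed.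
Scan⇒Word : ∀ {p zs k} → Scan (p ∷ c) m av as → Word (length av) p zs k →
            ∃[ zs′ ] Word 0 0 zs′ (length as + k) × zs′ ʳ++ 0 ∷ [] ≡ zs ʳ++ p ∷ c
Scan⇒Word start w = _ , w , refl
Scan⇒Word (skip {_ ∷ _} s) w = Scan⇒Word s (new w)
Scan⇒Word {k = k} (close {as = as} s p r≡∨<) w
  with zs , w′ , eq ← Scan⇒Word s (old (ℕ.≤-pred (Pick-rank< p)) r≡∨<
         (subst (λ l → Word l _ _ _) (sym (ℕ.suc-injective (Pick-length p))) w)) =
  zs , subst (Word 0 0 zs) (ℕ.+-suc (length as) k) w′ , eq

-- Scans from an abstract arc relation

module _
  (A : ℕ → ℕ → Set)
  (closer?   : ∀ j → Dec (∃[ i ] A i j))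
  (A⇒<       : ∀ {i j} → A i j → i < j)
  (A-unique  : ∀ {q i j i′ j′} → A i j → A i′ j′ →
               Touches q (i , j) → Touches q (i′ , j′) → i ≡ i′ × j ≡ j′)
  (¬adjacent : ∀ {i i′ j} → A i j → ¬ A i′ (suc j))
  (¬crossing : ∀ {i i′ j} → A i j → A i′ (suc (suc j)) → i′ ≤ j → i′ < i)
  where

  -- An opener other than m and outside `av` would lie on an arc already closed. By `A-unique` this
  -- is the arc ending at `suc m`, but the arcs of `s` end before m.
  available : ∀ {i} → Scan c m av as → (∀ {i j} → (i , j) ∈ as → A i j) →
              A i (suc m) → i ∈ m ∷ av
  available {m = m} {i = i} s sound a with i ℕ.≟ m
  ... | yes i≡m = here i≡m
  ... | no  i≢m with cover s (ℕ.≤∧≢⇒< (ℕ.≤-pred (A⇒< a)) i≢m)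
  ...   | inj₁ i∈av  = there i∈av
  ...   | inj₂ touch with _ , b∈ , t ← find touch
                     with refl ← proj₂ (A-unique (sound b∈) a t (inj₁ refl)) =
    contradiction (proj₂ (bounded s b∈)) (ℕ.<-asym (ℕ.n<1+n m))

  -- If the opener is not m and m - 1 is a closer, the two closers are at distance 2. Then
  -- `¬crossing` orders their openers, and `last-closer⁻` translates this into r < p.
  rank-condition : ∀ {p i r} → Scan (p ∷ c) m av as → (∀ {i j} → (i , j) ∈ as → A i j) →
                   A i (suc m) → Pick i (m ∷ av) av′ r → r ≡ length av ⊎ r < p
  rank-condition s sound a here      = inj₁ refl
  rank-condition s sound a (there q) = inj₂ (last-closer⁻ s q λ
    { refl b∈ → ¬crossing (sound b∈) a (ℕ.≤-pred (av< s (Pick⇒∈ q))) })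

  -- Units are split off at the right end. If the last point is a closer, the point before it
  -- becomes the X of its unit, being no closer by `¬adjacent`.
  scanArcs : ∀ m → ¬ (∃[ i ] A i m) →
             ∃₂ λ p c → ∃₂ λ av as → Scan (p ∷ c) m av as ×
               (∀ {i j} → (i , j) ∈ as → A i j) × (∀ {i j} → A i j → j < m → (i , j) ∈ as)
  scanArcs zero _ = _ , _ , _ , _ , start , (λ ()) , λ _ ()
  scanArcs (suc m) _ with closer? m
  scanArcs (suc m) _ | no ¬cl with _ , _ , _ , as , s , sound , complete ← scanArcs m ¬cl =
    _ , _ , _ , _ , skip s , sound , complete′
    where
    complete′ : ∀ {i j} → A i j → j < suc m → (i , j) ∈ as
    complete′ a j<1+m = complete a (ℕ.≤∧≢⇒< (ℕ.≤-pred j<1+m) λ { refl → ¬cl (_ , a) })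
  scanArcs (suc zero) _ | yes (i , a) = contradiction (A⇒< a) ℕ.n≮0
  scanArcs (suc (suc m)) _ | yes (i , a)
    with _ , _ , _ , as , s , sound , complete ← scanArcs m (λ { (_ , b) → ¬adjacent b a })
    with _ , _ , q ← ∈⇒Pick (available s sound a) =
    _ , _ , _ , _ , close s q (rank-condition s sound a q) ,
    (λ { (here refl) → a ; (there b∈) → sound b∈ }) , complete′
    where
    complete′ : ∀ {i′ j} → A i′ j → j < suc (suc m) → (i′ , j) ∈ (i , suc m) ∷ as
    complete′ {j = j} b j<2+m with j ℕ.≟ suc m
    ... | no j≢1+m = there (complete b (ℕ.≤∧≢⇒< (ℕ.≤-pred j<1+m)
      λ { refl → ¬adjacent b a }))
      where
      j<1+m : j < suc m
      j<1+m = ℕ.≤∧≢⇒< (ℕ.≤-pred j<2+m) j≢1+m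
    ... | yes refl = here (cong (_, suc m) (proj₁ (A-unique b a (inj₂ refl) (inj₂ refl))))

-- Codes as sequences

max-∷-≤ : ∀ {M y} → y ℤ.≤ M → ∀ l → max M (y ∷ l) ≡ max M l
max-∷-≤ {M} {y} y≤M l = ℤ.≤-antisym
  (max≤v⁺ (⊥≤max M l) (ℤ.≤-trans y≤M (⊥≤max M l) ∷ xs≤max M l))
  (max≤v⁺ (⊥≤max M (y ∷ l)) (All.tail (xs≤max M (y ∷ l))))

max-∷-≥ : ∀ {M y} → M ℤ.≤ y → ∀ l → max M (y ∷ l) ≡ max y l
max-∷-≥ {M} {y} M≤y l = ℤ.≤-antisym
  (max≤v⁺ (ℤ.≤-trans M≤y (⊥≤max y l)) (⊥≤max y l ∷ xs≤max y l))
  (max≤v⁺ (All.head (xs≤max M (y ∷ l))) (All.tail (xs≤max M (y ∷ l))))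

max<⁺ : ∀ {M v l} → M ℤ.< v → All (ℤ._< v) l → max M l ℤ.< v
max<⁺ M<v l<v = Product.uncurry ℤ.≤∧≢⇒< (max<v⁺ (strict M<v) (All.map strict l<v))
  where
  strict : ∀ {x y} → x ℤ.< y → x ℤ.≤ y × x ≢ y
  strict x<y = ℤ.<⇒≤ x<y , ℤ.<⇒≢ x<y

max<⁻ : ∀ {M v} l → max M l ℤ.< v → M ℤ.< v × All (ℤ._< v) l
max<⁻ {M} l max<v = ℤ.≤-<-trans (⊥≤max M l) max<v ,
                    All.map (λ x≤ → ℤ.≤-<-trans x≤ max<v) (xs≤max M l)

All-take⁺ : ∀ {A : Set} {P : A → Set} {n} (xs : Vec A n) (i : Fin n) →
            (∀ j → j Fin.< i → P (lookup xs j)) → All P (take (toℕ i) (toList xs))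
All-take⁺ (x ∷ xs) Fin.zero    h = []
All-take⁺ (x ∷ xs) (Fin.suc i) h =
  h Fin.zero (s≤s z≤n) ∷ All-take⁺ xs i (λ j j<i → h (Fin.suc j) (s≤s j<i))

All-take⁻ : ∀ {A : Set} {P : A → Set} {n} (xs : Vec A n) (i : Fin n) →
            All P (take (toℕ i) (toList xs)) → ∀ j → j Fin.< i → P (lookup xs j)
All-take⁻ (x ∷ xs) (Fin.suc i) (Px ∷ _)  Fin.zero    _         = Px
All-take⁻ (x ∷ xs) (Fin.suc i) (_ ∷ Pxs) (Fin.suc j) (s≤s j<i) = All-take⁻ xs i Pxs j j<i

module _ {n} {P : Pred (Fin (suc n)) 0ℓ} (P? : Decidable P) where

  private
    filter-map-suc : ∀ js → length (filter P? (map Fin.suc js)) ≡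
                            length (filter (P? ∘ Fin.suc) js)
    filter-map-suc []       = refl
    filter-map-suc (j ∷ js) with P? (Fin.suc j)
    ... | yes _ = cong suc (filter-map-suc js)
    ... | no  _ = filter-map-suc js

    filter-tabulate-suc : length (filter P? (tabulate Fin.suc)) ≡
                          length (filter (P? ∘ Fin.suc) (allFin n))
    filter-tabulate-suc = trans
      (cong (length ∘ filter P?) (sym (List.map-tabulate id Fin.suc)))
      (filter-map-suc (allFin n))

  count-accept : P Fin.zero → length (filter P? (allFin (suc n))) ≡
                              suc (length (filter (P? ∘ Fin.suc) (allFin n)))
  count-accept P0 = trans (cong length (List.filter-accept P? P0)) (cong suc filter-tabulate-suc)

  count-reject : ¬ P Fin.zero → length (filter P? (allFin (suc n))) ≡
                                length (filter (P? ∘ Fin.suc) (allFin n))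
  count-reject ¬P0 = trans (cong length (List.filter-reject P? ¬P0)) filter-tabulate-suc

-- The maximum before the i-th entry of xs, when a prefix of maximum M precedes xs.
runningMax : ∀ {n} → ℤ → Vec ℤ n → Fin n → ℤ
runningMax M xs i = max M (take (toℕ i) (toList xs))

IsRecord : ∀ {n} → ℤ → Vec ℤ n → Fin n → Set
IsRecord M xs i = runningMax M xs i ℤ.< lookup xs i

isRecord? : ∀ {n} M (xs : Vec ℤ n) → Decidable (IsRecord M xs)
isRecord? M xs i = runningMax M xs i ℤ.<? lookup xs i

numRecords : ∀ {n} → ℤ → Vec ℤ n → ℕ
numRecords {n} M xs = length (filter (isRecord? M xs) (allFin n))

-- An entry exceeds all earlier ones exactly if it exceeds their maximum. The `suc` counts x itself,
-- for which the condition is vacuous.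
numLTRMax-∷ : ∀ {n} x (xs : Vec ℤ n) → numLTRMax (x ∷ xs) ≡ suc (numRecords x xs)
numLTRMax-∷ {n} x xs = trans
  (count-accept (isLTRMax? (x ∷ xs)) (λ _ ()))
  (cong (suc ∘ length) (List.filter-≐ _ _ LTR≐record (allFin n)))
  where
  LTR≐record : (IsLTRMax (x ∷ xs) ∘ Fin.suc) ≐ IsRecord x xs
  LTR≐record =
    (λ {i} ltr → max<⁺ (ltr Fin.zero (s≤s z≤n))
      (All-take⁺ xs i (λ j j<i → ltr (Fin.suc j) (s≤s j<i)))) ,
    (λ { {i} r Fin.zero    _         → proj₁ (max<⁻ (take (toℕ i) (toList xs)) r)
       ; {i} r (Fin.suc j) (s≤s j<i) →
           All-take⁻ xs i (proj₂ (max<⁻ (take (toℕ i) (toList xs)) r)) j j<i })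

-- `Admissible M p xs`: xs may follow a prefix with maximum M and last entry p.
record Admissible {n} (M p : ℤ) (xs : Vec ℤ n) : Set where
  constructor admissible
  field
    growth  : ∀ i → 0ℤ ℤ.≤ lookup xs i × lookup xs i ℤ.≤ runningMax M xs i ℤ.+ 1ℤ
    descent : ∀ i → lookup xs i ℤ.< runningMax M xs i →
              lookup xs i ℤ.< lookup (p ∷ xs) (inject₁ i)

-- The equation `eq` treats two kinds of entry at once: y ≤ M with M′ = M, and y ≥ M with M′ = y.
module _ {n} {M M′ y : ℤ} {ys : Vec ℤ n} (eq : ∀ l → max M (y ∷ l) ≡ max M′ l) where

  private
    shift : ∀ i → runningMax M (y ∷ ys) (Fin.suc i) ≡ runningMax M′ ys i
    shift i = eq (take (toℕ i) (toList ys))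

    record≐ : (IsRecord M (y ∷ ys) ∘ Fin.suc) ≐ IsRecord M′ ys
    record≐ = (λ {i} → subst (ℤ._< lookup ys i) (shift i)) ,
              (λ {i} → subst (ℤ._< lookup ys i) (sym (shift i)))

  Admissible-tail : ∀ {p} → Admissible M p (y ∷ ys) → Admissible M′ y ys
  Admissible-tail (admissible g d) = admissible
    (λ i → Product.map₂ (subst (λ z → lookup ys i ℤ.≤ z ℤ.+ 1ℤ) (shift i)) (g (Fin.suc i)))
    (λ i y<max → d (Fin.suc i) (subst (lookup ys i ℤ.<_) (sym (shift i)) y<max))

  Admissible-∷ : ∀ {p} → 0ℤ ℤ.≤ y → y ℤ.≤ M ℤ.+ 1ℤ → (y ℤ.< M → y ℤ.< p) →
                 Admissible M′ y ys → Admissible M p (y ∷ ys)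
  Admissible-∷ 0≤y y≤M+1 desc (admissible g d) = admissible
    (λ { Fin.zero    → 0≤y , y≤M+1
       ; (Fin.suc i) →
           Product.map₂ (subst (λ z → lookup ys i ℤ.≤ z ℤ.+ 1ℤ) (sym (shift i))) (g i) })
    (λ { Fin.zero          → desc
       ; (Fin.suc i) y<max → d i (subst (lookup ys i ℤ.<_) (shift i) y<max) })

  numRecords-> : M ℤ.< y → numRecords M (y ∷ ys) ≡ suc (numRecords M′ ys)
  numRecords-> M<y = trans (count-accept (isRecord? M (y ∷ ys)) M<y)
    (cong (suc ∘ length) (List.filter-≐ _ _ record≐ (allFin n)))

  numRecords-≤ : ¬ M ℤ.< y → numRecords M (y ∷ ys) ≡ numRecords M′ ys
  numRecords-≤ M≮y = trans (count-reject (isRecord? M (y ∷ ys)) M≮y)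
    (cong length (List.filter-≐ _ _ record≐ (allFin n)))

-- Admissible vectors and words

Admissible⇒Word : ∀ {r} M p (ys : Vec ℤ r) → Admissible (+ M) (+ p) ys →
                  ∃₂ λ zs k → toList ys ≡ map +_ zs × Word M p zs k ×
                              numRecords (+ M) ys + k ≡ r
Admissible⇒Word M p [] _ = _ , _ , refl , [] , refl
Admissible⇒Word M p (-[1+ _ ] ∷ ys) adm with () ← proj₁ (Admissible.growth adm Fin.zero)
Admissible⇒Word M p (+ x ∷ ys) adm with x ℕ.≤? M
... | yes x≤M
  with zs , k , eq , w , count ←
         Admissible⇒Word M x ys (Admissible-tail (max-∷-≤ (+≤+ x≤M)) adm) =
  x ∷ zs , suc k , cong (+ x ∷_) eq , old x≤M x≡M∨x<p w ,
  trans (cong (_+ suc k) (numRecords-≤ {ys = ys} (max-∷-≤ (+≤+ x≤M)) (ℤ.≤⇒≯ (+≤+ x≤M))))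
    (trans (ℕ.+-suc _ k) (cong suc count))
  where
  x≡M∨x<p : x ≡ M ⊎ x < p
  x≡M∨x<p with x ℕ.≟ M
  ... | yes x≡M = inj₁ x≡M
  ... | no  x≢M = inj₂ (ℤ.drop‿+<+ (Admissible.descent adm Fin.zero (+<+ (ℕ.≤∧≢⇒< x≤M x≢M))))
... | no x≰M
  -- By `growth`, x is at most M + 1, so an entry above M is exactly M + 1.
  with refl ← ℕ.≤-antisym
         (subst (x ≤_) (ℕ.+-comm M 1) (ℤ.drop‿+≤+ (proj₂ (Admissible.growth adm Fin.zero))))
         (ℕ.≰⇒> x≰M)
  with zs , k , eq , w , count ←
         Admissible⇒Word (suc M) (suc M) ys (Admissible-tail (max-∷-≥ (+≤+ (ℕ.n≤1+n M))) adm) =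
  suc M ∷ zs , k , cong (+ suc M ∷_) eq , new w ,
  trans (cong (_+ k) (numRecords-> {ys = ys} (max-∷-≥ (+≤+ (ℕ.n≤1+n M))) (+<+ ℕ.≤-refl)))
    (cong suc count)

Word⇒Admissible : ∀ {M p zs k r} (ys : Vec ℤ r) → Word M p zs k → toList ys ≡ map +_ zs →
                  Admissible (+ M) (+ p) ys × numRecords (+ M) ys + k ≡ r
Word⇒Admissible [] [] _ = admissible (λ ()) (λ ()) , refl
Word⇒Admissible {M} {p} {k = k} (y ∷ ys) (new w) eq
  with refl ← List.∷-injectiveˡ eq
  with adm , count ← Word⇒Admissible ys w (List.∷-injectiveʳ eq) =
  Admissible-∷ (max-∷-≥ M≤1+M) (+≤+ z≤n)
    (ℤ.≤-reflexive (cong +_ (ℕ.+-comm 1 M)))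
    (λ 1+M<M → contradiction M≤1+M (ℤ.<⇒≱ 1+M<M)) adm ,
  trans (cong (_+ k) (numRecords-> {ys = ys} (max-∷-≥ M≤1+M) (+<+ ℕ.≤-refl)))
    (cong suc count)
  where
  M≤1+M : + M ℤ.≤ + suc M
  M≤1+M = +≤+ (ℕ.n≤1+n M)
Word⇒Admissible {M} {p} (y ∷ ys) (old {x} {k = k} x≤M x≡M∨x<p w) eq
  with refl ← List.∷-injectiveˡ eq
  with adm , count ← Word⇒Admissible ys w (List.∷-injectiveʳ eq) =
  Admissible-∷ (max-∷-≤ (+≤+ x≤M)) (+≤+ z≤n)
    (+≤+ (ℕ.≤-trans x≤M (ℕ.m≤m+n M 1)))
    (λ x<M → +<+ ([ (λ x≡M → contradiction x≡M (ℕ.<⇒≢ (ℤ.drop‿+<+ x<M))) , id ]′ x≡M∨x<p)) adm ,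
  trans (cong (_+ suc k) (numRecords-≤ {ys = ys} (max-∷-≤ (+≤+ x≤M)) (ℤ.≤⇒≯ (+≤+ x≤M))))
    (trans (ℕ.+-suc _ k) (cong suc count))

Sequence⇒Word : ∀ {r k} → k ≤ r → (x : RestrictedSequence (suc r) k) →
                ∃[ zs ] toList (RestrictedSequence.seq x) ≡ map +_ (0 ∷ zs) × Word 0 0 zs k
Sequence⇒Word {r} {k} k≤r record
  { seq = x₀ ∷ ys ; numLTRMax≡ = num ; startsAt0 = start₀ ; growth = grow ; descent = desc }
  with refl ← start₀ Fin.zero refl
  with zs , k′ , eq , w , count ← Admissible⇒Word 0 0 ys (admissible
         (λ i → grow (Fin.suc i) (s≤s z≤n))
         (λ i → desc (Fin.suc i) (s≤s z≤n) (proj₁ (grow (Fin.suc i) (s≤s z≤n))))) =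
  zs , cong (0ℤ ∷_) eq , subst (Word 0 0 zs) k′≡k w
  where
  -- One of the n - k maxima is x₀, and k ≤ r makes the truncated subtraction exact.
  num′ : numRecords 0ℤ ys ≡ r ∸ k
  num′ = ℕ.suc-injective (trans (sym (numLTRMax-∷ 0ℤ ys)) (trans num (ℕ.+-∸-assoc 1 k≤r)))

  k′≡k : k′ ≡ k
  k′≡k = ℕ.+-cancelˡ-≡ (r ∸ k) k′ k
    (trans (cong (_+ k′) (sym num′)) (trans count (sym (ℕ.m∸n+n≡m k≤r))))

Word⇒Sequence : ∀ {zs k r} → Word 0 0 zs k → length zs ≡ r →
                ∃[ x ] toList (RestrictedSequence.seq {suc r} {k} x) ≡ map +_ (0 ∷ zs)
Word⇒Sequence {zs} {k} w refl = record
  { seq         = 0ℤ ∷ ys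
  ; numLTRMax≡  = trans (numLTRMax-∷ 0ℤ ys) num
  ; startsAt0   = λ { Fin.zero _ → refl }
  ; growth      = λ { (Fin.suc i) _ → Admissible.growth adm i }
  ; descent     = λ { (Fin.suc i) _ _ → Admissible.descent adm i }
  } , cong (0ℤ ∷_) ys≡
  where
  ys : Vec ℤ (length zs)
  ys = Vec.map +_ (Vec.fromList zs)

  ys≡ : toList ys ≡ map +_ zs
  ys≡ = trans (Vec.toList-map +_ (Vec.fromList zs)) (cong (λ l → map +_ l) (Vec.toList∘fromList zs))

  adm : Admissible 0ℤ 0ℤ ys
  adm = proj₁ (Word⇒Admissible ys w ys≡)

  count : numRecords 0ℤ ys + k ≡ length zs
  count = proj₂ (Word⇒Admissible ys w ys≡)

  num : suc (numRecords 0ℤ ys) ≡ suc (length zs) ∸ k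
  num = trans (sym (ℕ.m+n∸n≡m (suc (numRecords 0ℤ ys)) k)) (cong (λ l → suc l ∸ k) count)

-- Codes of set partitions

AllPairs-lookup : ∀ {A : Set} {R : A → A → Set} {x y xs} → Symmetric R →
                  AllPairs R xs → x ∈ xs → y ∈ xs → x ≡ y ⊎ R x y
AllPairs-lookup sym-R (_ ∷ _)   (here refl) (here refl) = inj₁ refl
AllPairs-lookup sym-R (Rx ∷ _)  (here refl) (there y∈)  = inj₂ (All.lookup Rx y∈)
AllPairs-lookup sym-R (Ry ∷ _)  (there x∈)  (here refl) = inj₂ (sym-R (All.lookup Ry x∈))
AllPairs-lookup sym-R (_ ∷ Rxs) (there x∈)  (there y∈)  = AllPairs-lookup sym-R Rxs x∈ y∈

∈⋃⁺ : ∀ {x : Fin m} {B Bs} → B ∈ Bs → x Subset.∈ B → x Subset.∈ ⋃ Bs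
∈⋃⁺ (here refl) x∈B = Subset.x∈p∪q⁺ (inj₁ x∈B)
∈⋃⁺ (there B∈)  x∈B = Subset.x∈p∪q⁺ (inj₂ (∈⋃⁺ B∈ x∈B))

∈⋃⁻ : ∀ {x : Fin m} Bs → x Subset.∈ ⋃ Bs → ∃[ B ] B ∈ Bs × x Subset.∈ B
∈⋃⁻ []       x∈ = contradiction x∈ Subset.∉⊥
∈⋃⁻ (B ∷ Bs) x∈ with Subset.x∈p∪q⁻ B (⋃ Bs) x∈
... | inj₁ x∈B = B , here refl , x∈B
... | inj₂ x∈⋃ with C , C∈ , x∈C ← ∈⋃⁻ Bs x∈⋃ = C , there C∈ , x∈C

-- The singleton {a}; empty if a ≥ m.
point : ∀ m → ℕ → Subset m
point zero    _       = []
point (suc m) zero    = inside ∷ ⊥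
point (suc m) (suc a) = outside ∷ point m a

point-toℕ : (i : Fin m) → point m (toℕ i) ≡ ⁅ i ⁆
point-toℕ Fin.zero    = refl
point-toℕ (Fin.suc i) = cong (outside ∷_) (point-toℕ i)

∈point⁻ : ∀ {x : Fin m} a → x Subset.∈ point m a → toℕ x ≡ a
∈point⁻ {x = Fin.zero}  zero    _           = refl
∈point⁻ {x = Fin.suc x} zero    (there x∈)  = contradiction x∈ Subset.∉⊥
∈point⁻ {x = Fin.suc x} (suc a) (there x∈)  = cong suc (∈point⁻ a x∈)

-- A pair (q , q) gives a singleton, so that pairs of numbers describe all blocks of a partial
-- matching.
block : ∀ m → ℕ × ℕ → Subset m
block m (a , b) = point m a ∪ point m b

block-toℕ : (i j : Fin m) → block m (toℕ i , toℕ j) ≡ ⁅ i ⁆ ∪ ⁅ j ⁆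
block-toℕ i j = cong₂ _∪_ (point-toℕ i) (point-toℕ j)

∈block⁻ : ∀ {x : Fin m} a → x Subset.∈ block m a → Touches (toℕ x) a
∈block⁻ {m} (a , b) = Sum.map (∈point⁻ a) (∈point⁻ b) ∘ Subset.x∈p∪q⁻ (point m a) (point m b)

∈block⁺ : ∀ {x : Fin m} {a} → Touches (toℕ x) a → x Subset.∈ block m a
∈block⁺ {x = x} = Subset.x∈p∪q⁺ ∘ Sum.map (λ { refl → x∈ }) (λ { refl → x∈ })
  where
  x∈ : x Subset.∈ point _ (toℕ x)
  x∈ = subst (x Subset.∈_) (sym (point-toℕ x)) (Subset.x∈⁅x⁆ x)

∈pair⁻ : ∀ {x i j : Fin m} → x Subset.∈ ⁅ i ⁆ ∪ ⁅ j ⁆ → Touches (toℕ x) (toℕ i , toℕ j)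
∈pair⁻ {x = x} {i} {j} = ∈block⁻ (toℕ i , toℕ j) ∘ subst (x Subset.∈_) (sym (block-toℕ i j))

∈pair⁺ : ∀ {x i j : Fin m} → Touches (toℕ x) (toℕ i , toℕ j) → x Subset.∈ ⁅ i ⁆ ∪ ⁅ j ⁆
∈pair⁺ {x = x} {i} {j} = subst (x Subset.∈_) (block-toℕ i j) ∘ ∈block⁺

Touches-both : ∀ {i j a b} → i < j → a < b → Touches i (a , b) → Touches j (a , b) →
               i ≡ a × j ≡ b
Touches-both i<j a<b (inj₁ refl) (inj₁ refl) = contradiction i<j (ℕ.<-irrefl refl)
Touches-both i<j a<b (inj₁ i≡a)  (inj₂ j≡b)  = i≡a , j≡b
Touches-both i<j a<b (inj₂ refl) (inj₁ refl) = contradiction i<j (ℕ.<-asym a<b)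
Touches-both i<j a<b (inj₂ refl) (inj₂ refl) = contradiction i<j (ℕ.<-irrefl refl)

∣pair∣≡1 : (i : Fin m) → ∣ ⁅ i ⁆ ∪ ⁅ i ⁆ ∣ ≡ 1
∣pair∣≡1 i = trans (cong ∣_∣ (Subset.∪-idem ⁅ i ⁆)) (Subset.∣⁅x⁆∣≡1 i)

∣pair∣≡2 : ∀ {i j : Fin m} → i Fin.< j → ∣ ⁅ i ⁆ ∪ ⁅ j ⁆ ∣ ≡ 2
∣pair∣≡2 {i = Fin.zero}  {Fin.suc j} _         =
  cong suc (trans (cong ∣_∣ (Subset.∪-identityˡ ⁅ j ⁆)) (Subset.∣⁅x⁆∣≡1 j))
∣pair∣≡2 {i = Fin.suc i} {Fin.suc j} (s≤s i<j) = ∣pair∣≡2 i<j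

∣p∣≤0 : (p : Subset m) → ∣ p ∣ ≤ 0 → p ≡ ⊥
∣p∣≤0 []            _ = refl
∣p∣≤0 (outside ∷ p) h = cong (outside ∷_) (∣p∣≤0 p h)

∣p∣≤1 : (p : Subset m) → ∣ p ∣ ≤ 1 → p ≡ ⊥ ⊎ ∃[ i ] p ≡ ⁅ i ⁆
∣p∣≤1 []            _       = inj₁ refl
∣p∣≤1 (outside ∷ p) h       = Sum.map (cong (outside ∷_))
  (Product.map Fin.suc (cong (outside ∷_))) (∣p∣≤1 p h)
∣p∣≤1 (inside ∷ p)  (s≤s h) = inj₂ (Fin.zero , cong (inside ∷_) (∣p∣≤0 p h))

∣p∣≤2 : (p : Subset m) → ∣ p ∣ ≤ 2 → p ≡ ⊥ ⊎ ∃₂ λ i j → i Fin.≤ j × p ≡ ⁅ i ⁆ ∪ ⁅ j ⁆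
∣p∣≤2 []            _       = inj₁ refl
∣p∣≤2 (outside ∷ p) h with ∣p∣≤2 p h
... | inj₁ refl                 = inj₁ refl
... | inj₂ (i , j , i≤j , refl) = inj₂ (Fin.suc i , Fin.suc j , s≤s i≤j , refl)
∣p∣≤2 (inside ∷ p)  (s≤s h) with ∣p∣≤1 p h
... | inj₁ refl       =
  inj₂ (Fin.zero , Fin.zero , z≤n , cong (inside ∷_) (sym (Subset.∪-idem ⊥)))
... | inj₂ (j , refl) =
  inj₂ (Fin.zero , Fin.suc j , z≤n , cong (inside ∷_) (sym (Subset.∪-identityˡ ⁅ j ⁆)))

∃toℕ : ∀ {a} → a < m → ∃[ i ] toℕ {m} i ≡ a
∃toℕ a<m = fromℕ< a<m , Fin.toℕ-fromℕ< a<m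

_≟ˢ_ : DecidableEquality (Subset m)
_≟ˢ_ = Vec.≡-dec Bool._≟_

module _ (π : SetPartition m) where

  sharing⇒≡ : ∀ {B C x} → B ∈ blocks π → C ∈ blocks π → x Subset.∈ B → x Subset.∈ C → B ≡ C
  sharing⇒≡ B∈ C∈ x∈B x∈C with
    AllPairs-lookup (λ {B} {C} → subst Empty (Subset.∩-comm B C)) (disjoint π) B∈ C∈
  ... | inj₁ B≡C   = B≡C
  ... | inj₂ empty = contradiction (_ , Subset.x∈p∩q⁺ (x∈B , x∈C)) empty

  block-of : ∀ x → ∃[ B ] B ∈ blocks π × x Subset.∈ B
  block-of x = ∈⋃⁻ (blocks π) (subst (x Subset.∈_) (sym (covering π)) Subset.∈⊤)

  blocks-unique : Unique (blocks π)
  blocks-unique = distinct (nonempty π) (disjoint π)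
    where
    distinct : ∀ {Bs} → All Nonempty Bs → AllPairs (λ B C → Empty (B ∩ C)) Bs → Unique Bs
    distinct []               []       = []
    distinct ((x , x∈B) ∷ ne) (d ∷ ds) =
      All.map (λ { empty refl → empty (x , Subset.x∈p∩q⁺ (x∈B , x∈B)) }) d ∷ distinct ne ds

  -- The blocks of both arcs contain q and hence coincide; the order of the endpoints then
  -- identifies them one by one.
  arcs-unique : ∀ {q i j i′ j′} → IsArc π i j → IsArc π i′ j′ →
                Touches (toℕ q) (toℕ i , toℕ j) → Touches (toℕ q) (toℕ i′ , toℕ j′) →
                i ≡ i′ × j ≡ j′
  arcs-unique {q} {i} {j} {i′} {j′} (i<j , p∈) (i′<j′ , p′∈) t t′ =
    Product.map Fin.toℕ-injective Fin.toℕ-injective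
      (Touches-both i<j i′<j′ (touches (inj₁ refl)) (touches (inj₂ refl)))
    where
    pair≡ : ⁅ i ⁆ ∪ ⁅ j ⁆ ≡ ⁅ i′ ⁆ ∪ ⁅ j′ ⁆
    pair≡ = sharing⇒≡ {x = q} p∈ p′∈ (∈pair⁺ t) (∈pair⁺ t′)

    touches : ∀ {x} → Touches (toℕ x) (toℕ i , toℕ j) → Touches (toℕ x) (toℕ i′ , toℕ j′)
    touches {x} = ∈pair⁻ ∘ subst (x Subset.∈_) pair≡ ∘ ∈pair⁺

  isArc? : ∀ i j → Dec (IsArc π i j)
  isArc? i j = i Fin.<? j ×-dec (⁅ i ⁆ ∪ ⁅ j ⁆) ∈? blocks π
    where open DecMembership (_≟ˢ_ {m}) using (_∈?_)

  -- The arcs as a relation on numbers, the form that `scanArcs` takes. `ArcAt⁻` replaces the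
  -- indices `toℕ i` and `toℕ j` by equations.
  data ArcAt : ℕ → ℕ → Set where
    arc : ∀ {i j} → IsArc π i j → ArcAt (toℕ i) (toℕ j)

  ArcAt⁻ : ∀ {a b} → ArcAt a b → ∃₂ λ i j → IsArc π i j × toℕ i ≡ a × toℕ j ≡ b
  ArcAt⁻ (arc a) = _ , _ , a , refl , refl

  arcEndingAt? : ∀ b → Dec (∃[ a ] ArcAt a b)
  arcEndingAt? b with b ℕ.<? m
  ... | no b≮m = no λ { (_ , arc {j = j} _) → b≮m (Fin.toℕ<n j) }
  ... | yes b<m = map′
    (λ { (i , a) → toℕ i , subst (ArcAt (toℕ i)) (Fin.toℕ-fromℕ< b<m) (arc a) })
    (λ { (_ , arc {i} a) → i , subst (IsArc π i) (sym (Fin.fromℕ<-toℕ _ b<m)) a })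
    (Fin.any? λ i → isArc? i (fromℕ< b<m))

  record Encodes (as : Arcs) : Set where
    constructor encodes
    field
      sound    : ∀ {i j} → (toℕ i , toℕ j) ∈ as → IsArc π i j
      complete : ∀ {i j} → IsArc π i j → (toℕ i , toℕ j) ∈ as

open Encodes

-- The closer of an arc lies in its block, but in no block of another arc, since the arcs are apart.
Scan-unique : Scan c m av as → Unique (map (block m) as)
Scan-unique {m = m} s = AllPairs.map⁺ (distinct (bounded s) (apart s))
  where
  distinct : ∀ {as} → (∀ {i j} → (i , j) ∈ as → i < j × j < m) → AllPairs Apart as →
             AllPairs (_≢_ on block m) as
  distinct bd []                     = []
  distinct {(i , j) ∷ _} bd (ap ∷ aps) = All.map new≢ ap ∷ distinct (bd ∘ there) aps
    where
    x : Fin m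
    x = fromℕ< (proj₂ (bd (here refl)))

    x-touches : Touches (toℕ x) (i , j)
    x-touches = inj₂ (Fin.toℕ-fromℕ< _)

    new≢ : ∀ {b} → Apart (i , j) b → block m (i , j) ≢ block m b
    new≢ {b} ap eq = ap x-touches (∈block⁻ b (subst (x Subset.∈_) eq (∈block⁺ x-touches)))

module _ (π : SetPartition m) (≤2 : IsPartialMatching π) where

  block≡pair : ∀ {B} → B ∈ blocks π → ∃₂ λ i j → i Fin.≤ j × B ≡ ⁅ i ⁆ ∪ ⁅ j ⁆
  block≡pair {B} B∈ with ∣p∣≤2 B (All.lookup ≤2 B∈)
  ... | inj₂ pair = pair
  ... | inj₁ refl with _ , x∈⊥ ← All.lookup (nonempty π) B∈ = contradiction x∈⊥ Subset.∉⊥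

  -- Both lists are free of repetitions and have the same members, so one is a permutation of the
  -- other.
  numArcs≡length : Scan c m av as → Encodes π as → numArcs π ≡ length as
  numArcs≡length {as = as} s enc = trans
    (↭-length (∼bag⇒↭ (unique∧set⇒bag
      (Unique.filter⁺ size2? (blocks-unique π)) (Scan-unique s) (mk⇔ to from))))
    (List.length-map (block m) as)
    where
    size2? : ∀ B → Dec (∣ B ∣ ≡ 2)
    size2? B = ∣ B ∣ ℕ.≟ 2

    to : ∀ {B} → B ∈ filter size2? (blocks π) → B ∈ map (block m) as
    to B∈f with B∈ , ∣B∣≡2 ← ∈-filter⁻ size2? {xs = blocks π} B∈f with block≡pair B∈
    ... | i , j , i≤j , refl = subst (_∈ map (block m) as) (block-toℕ i j)
      (∈-map⁺ (block m) (complete enc (Fin.≤∧≢⇒< i≤j i≢j , B∈)))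
      where
      i≢j : i ≢ j
      i≢j refl with () ← trans (sym (∣pair∣≡1 i)) ∣B∣≡2

    from : ∀ {B} → B ∈ map (block m) as → B ∈ filter size2? (blocks π)
    from B∈ with (a , b) , ab∈ , refl ← ∈-map⁻ (block m) B∈ with bounded s ab∈
    ... | a<b , b<m with i , refl ← ∃toℕ (ℕ.<-trans a<b b<m) | j , refl ← ∃toℕ b<m
      rewrite block-toℕ i j =
      ∈-filter⁺ size2? (proj₂ (sound enc {i} {j} ab∈)) (∣pair∣≡2 a<b)

-- Two-element blocks are arcs, which π and π′ share. For a singleton {i} of π, the block of i in π′
-- is no arc: it would be an arc of π too and meet {i}, so that a block of size 2 would equal one of
-- size 1.
Encodes⇒⊆ : ∀ {π π′ : SetPartition m} → IsPartialMatching π → IsPartialMatching π′ →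
            Encodes π as → Encodes π′ as → ∀ {B} → B ∈ blocks π → B ∈ blocks π′
Encodes⇒⊆ {π = π} {π′} ≤2 ≤2′ enc enc′ B∈ with block≡pair π ≤2 B∈
... | i , j , i≤j , refl with i Fin.≟ j
... | no i≢j = proj₂ (sound enc′ (complete enc (Fin.≤∧≢⇒< i≤j i≢j , B∈)))
... | yes refl with _ , B′∈ , i∈B′ ← block-of π′ i with block≡pair π′ ≤2′ B′∈
... | i′ , j′ , i′≤j′ , refl with i′ Fin.≟ j′
... | yes refl with refl ← Fin.toℕ-injective {i = i} {i′} ([ id , id ]′ (∈pair⁻ i∈B′)) = B′∈
... | no i′≢j′
  with i′<j′ ← Fin.≤∧≢⇒< i′≤j′ i′≢j′
  with _ , p′∈ ← sound enc (complete enc′ (i′<j′ , B′∈))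
  with () ← trans (sym (∣pair∣≡1 i))
              (trans (cong ∣_∣ (sharing⇒≡ π {x = i} B∈ p′∈ (∈pair⁺ (inj₁ refl)) i∈B′))
                     (∣pair∣≡2 i′<j′))

blocks⊆⇒arcs⊆ : ∀ {π π′ : SetPartition m} {as′} → Scan c m av as → Encodes π as →
                Encodes π′ as′ → (∀ {B} → B ∈ blocks π → B ∈ blocks π′) →
                ∀ {a} → a ∈ as → a ∈ as′
blocks⊆⇒arcs⊆ s enc enc′ ⊆ {a , b} ab∈ with a<b , b<m ← bounded s ab∈
  with i , refl ← ∃toℕ (ℕ.<-trans a<b b<m) | j , refl ← ∃toℕ b<m =
  complete enc′ (Product.map₂ ⊆ (sound enc {i} {j} ab∈))

-- The matching of a scan

module _ (s : Scan c m av as) where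

  private
    singles : Arcs
    singles = map (λ q → q , q) av

    parts : Arcs
    parts = singles ++ as

    single∈ : ∀ {q} → q ∈ av → (q , q) ∈ parts
    single∈ q∈ = ∈-++⁺ˡ (∈-map⁺ (λ q → q , q) q∈)

    ∈parts⁻ : ∀ {a} → a ∈ parts → (∃[ q ] q ∈ av × a ≡ (q , q)) ⊎ a ∈ as
    ∈parts⁻ a∈ = Sum.map₁ (∈-map⁻ (λ q → q , q)) (∈-++⁻ singles a∈)

    parts-apart : AllPairs Apart parts
    parts-apart = AllPairs.++⁺
      (AllPairs.map⁺ (AllPairs.map single-apart (AllPairs.tail (decreasing s))))
      (apart s)
      (All.map⁺ (All.tabulate λ q∈ → All.tabulate λ a∈ → λ
        { (inj₁ refl) → untouched s q∈ a∈ ; (inj₂ refl) → untouched s q∈ a∈ }))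
      where
      single-apart : ∀ {a b} → a > b → Apart (a , a) (b , b)
      single-apart a>b t t′ with [ id , id ]′ t | [ id , id ]′ t′
      ... | refl | refl = ℕ.<-irrefl refl a>b

    parts-bounded : ∀ {a b} → (a , b) ∈ parts → a ≤ b × b < m
    parts-bounded a∈ with ∈parts⁻ a∈
    ... | inj₁ (q , q∈ , refl) = ℕ.≤-refl , av< s q∈
    ... | inj₂ ab∈             = Product.map₁ ℕ.<⇒≤ (bounded s ab∈)

    parts-cover : ∀ (x : Fin m) → ∃[ a ] a ∈ parts × Touches (toℕ x) a
    parts-cover x with cover s (Fin.toℕ<n x)
    ... | inj₁ x∈av  = _ , single∈ x∈av , inj₁ refl
    ... | inj₂ touch with a , a∈ , t ← find touch = a , ∈-++⁺ʳ singles a∈ , t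

    ∈parts⇒pair : ∀ {a} → a ∈ parts →
                  ∃₂ λ (i j : Fin m) → a ≡ (toℕ i , toℕ j) × i Fin.≤ j
    ∈parts⇒pair {a , b} ab∈ with a≤b , b<m ← parts-bounded ab∈
      with i , refl ← ∃toℕ (ℕ.≤-<-trans a≤b b<m) | j , refl ← ∃toℕ b<m = i , j , refl , a≤b

  Scan⇒Partition : SetPartition m
  Scan⇒Partition = record
    { blocks   = map (block m) parts
    ; nonempty = All.map⁺ (All.tabulate part-nonempty)
    ; disjoint = AllPairs.map⁺ (AllPairs.map apart⇒empty parts-apart)
    ; covering = Subset.⊆-antisym Subset.⊆⊤ covered
    }
    where
    part-nonempty : ∀ {a} → a ∈ parts → Nonempty (block m a)
    part-nonempty a∈ with i , _ , refl , _ ← ∈parts⇒pair a∈ = i , ∈block⁺ {x = i} (inj₁ refl)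

    apart⇒empty : ∀ {a b} → Apart a b → Empty (block m a ∩ block m b)
    apart⇒empty {a} {b} ap (x , x∈) with x∈a , x∈b ← Subset.x∈p∩q⁻ (block m a) (block m b) x∈ =
      ap (∈block⁻ a x∈a) (∈block⁻ b x∈b)

    covered : ⊤ Subset.⊆ ⋃ (map (block m) parts)
    covered {x} _ with a , a∈ , t ← parts-cover x = ∈⋃⁺ (∈-map⁺ (block m) a∈) (∈block⁺ t)

  Scan⇒isPartialMatching : IsPartialMatching Scan⇒Partition
  Scan⇒isPartialMatching = All.map⁺ (All.tabulate ≤2)
    where
    ≤2 : ∀ {a} → a ∈ parts → ∣ block m a ∣ ≤ 2
    ≤2 a∈ with i , j , refl , i≤j ← ∈parts⇒pair a∈ rewrite block-toℕ i j with i Fin.≟ j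
    ... | yes refl rewrite ∣pair∣≡1 i = s≤s z≤n
    ... | no  i≢j  = ℕ.≤-reflexive (∣pair∣≡2 (Fin.≤∧≢⇒< i≤j i≢j))

  Scan⇒Encodes : Encodes Scan⇒Partition as
  Scan⇒Encodes = encodes to from
    where
    to : ∀ {i j : Fin m} → (toℕ i , toℕ j) ∈ as → IsArc Scan⇒Partition i j
    to {i} {j} ij∈ = proj₁ (bounded s ij∈) ,
      subst (_∈ map (block m) parts) (block-toℕ i j)
        (∈-map⁺ (block m) (∈-++⁺ʳ singles ij∈))

    from : ∀ {i j : Fin m} → IsArc Scan⇒Partition i j → (toℕ i , toℕ j) ∈ as
    from {i} {j} (i<j , p∈)
      with (a , b) , ab∈ , eq ← ∈-map⁻ (block m) p∈ = arc∈ (∈parts⁻ ab∈)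
      where
      touches : ∀ {x} → Touches (toℕ x) (toℕ i , toℕ j) → Touches (toℕ x) (a , b)
      touches {x} = ∈block⁻ (a , b) ∘ subst (x Subset.∈_) eq ∘ ∈pair⁺

      arc∈ : (∃[ q ] q ∈ av × (a , b) ≡ (q , q)) ⊎ (a , b) ∈ as → (toℕ i , toℕ j) ∈ as
      arc∈ (inj₁ (q , _ , refl)) = contradiction
        (trans ([ id , id ]′ (touches (inj₁ refl))) (sym ([ id , id ]′ (touches (inj₂ refl)))))
        (ℕ.<⇒≢ i<j)
      arc∈ (inj₂ ab∈′) with refl , refl ← Touches-both i<j (proj₁ (bounded s ab∈′))
        (touches (inj₁ refl)) (touches (inj₂ refl)) = ab∈′

  Scan⇒Matching : ∃[ M ] Encodes (RestrictedMatching.partition {m} {length as} M) as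
  Scan⇒Matching = record
    { partition          = Scan⇒Partition
    ; isPartialMatching  = Scan⇒isPartialMatching
    ; numArcs≡k          = numArcs≡length Scan⇒Partition Scan⇒isPartialMatching s Scan⇒Encodes
    ; no-2-rightCrossing = λ (_ , _ , _ , _ , a , b , i<i′ , i′<j , j<j′ , d≤2) →
        no-2-crossing s (complete Scan⇒Encodes a) (complete Scan⇒Encodes b) i<i′ i′<j j<j′ d≤2
    ; no-rightNesting    = λ (i , _ , _ , j′ , a , b , _ , _ , _ , eq) →
        no-adjacent-closers s (complete Scan⇒Encodes b)
          (subst (λ l → (toℕ i , l) ∈ as) (trans eq (ℕ.+-comm (toℕ j′) 1))
            (complete Scan⇒Encodes a))
    } , Scan⇒Encodes

-- The scan of a matching

module _ {k} (M : RestrictedMatching m k) where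

  open RestrictedMatching M renaming (partition to π)

  private
    ¬ArcAt-m : ¬ (∃[ a ] ArcAt π a m)
    ¬ArcAt-m (_ , x) with _ , j , _ , _ , j≡m ← ArcAt⁻ π x = ℕ.<⇒≢ (Fin.toℕ<n j) j≡m

    IsArc-toℕ : ∀ {i j} → ArcAt π (toℕ i) (toℕ j) → IsArc π i j
    IsArc-toℕ x with _ , _ , a , eqᵢ , eqⱼ ← ArcAt⁻ π x
                with refl ← Fin.toℕ-injective eqᵢ | refl ← Fin.toℕ-injective eqⱼ = a

    ArcAt⇒< : ∀ {a b} → ArcAt π a b → a < b
    ArcAt⇒< (arc (i<j , _)) = i<j

    ArcAt-unique : ∀ {q a b a′ b′} → ArcAt π a b → ArcAt π a′ b′ →
                   Touches q (a , b) → Touches q (a′ , b′) → a ≡ a′ × b ≡ b′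
    ArcAt-unique (arc {i} {j} a) (arc a′) t t′ with t
    ... | inj₁ refl with refl , refl ← arcs-unique π {q = i} a a′ t t′ = refl , refl
    ... | inj₂ refl with refl , refl ← arcs-unique π {q = j} a a′ t t′ = refl , refl

    -- If i < i′, the arcs form a 2-right crossing; if i′ = i or i′ = j, two different arcs share a
    -- point.
    openers-decrease : ∀ {i j i′ j′} → IsArc π i j → IsArc π i′ j′ → j Fin.< j′ →
                       toℕ j′ ∸ toℕ j ≤ 2 → i′ Fin.≤ j → i′ Fin.< i
    openers-decrease {i} {j} {i′} {j′} a a′ j<j′ d≤2 i′≤j with ℕ.<-cmp (toℕ i) (toℕ i′)
    ... | tri> _ _ i′<i = i′<i
    ... | tri≈ _ i≡i′ _ = contradiction
      (cong toℕ (proj₂ (arcs-unique π {q = i} a a′ (inj₁ refl) (inj₁ i≡i′)))) (ℕ.<⇒≢ j<j′)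
    ... | tri< i<i′ _ _ = contradiction
      (i , j , i′ , j′ , a , a′ , i<i′ , ℕ.≤∧≢⇒< i′≤j i′≢j , j<j′ , d≤2) no-2-rightCrossing
      where
      i′≢j : toℕ i′ ≢ toℕ j
      i′≢j i′≡j = ℕ.<⇒≢ j<j′
        (cong toℕ (proj₂ (arcs-unique π {q = i′} a a′ (inj₂ i′≡j) (inj₁ refl))))

    -- Closers at distance 1 cannot belong to crossing arcs, so the arcs are nested, and this is a
    -- right nesting.
    ¬adjacent : ∀ {i j i′ j′} → IsArc π i j → IsArc π i′ j′ → toℕ j′ ≢ suc (toℕ j)
    ¬adjacent {i} {j} {i′} {j′} a a′ eq = no-rightNesting
      (i′ , j′ , i , j , a′ , a ,
       openers-decrease a a′ j<j′ d≤2 (ℕ.≤-pred (subst (toℕ i′ <_) eq (proj₁ a′))) ,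
       proj₁ a , j<j′ , trans eq (ℕ.+-comm 1 (toℕ j)))
      where
      j<j′ : toℕ j < toℕ j′
      j<j′ = ℕ.≤-reflexive (sym eq)

      d≤2 : toℕ j′ ∸ toℕ j ≤ 2
      d≤2 rewrite eq | ℕ.m+n∸n≡m 1 (toℕ j) = s≤s z≤n

    crossing : ∀ {i j i′ j′} → IsArc π i j → IsArc π i′ j′ →
               toℕ j′ ≡ suc (suc (toℕ j)) → i′ Fin.≤ j → i′ Fin.< i
    crossing {j = j} {j′ = j′} a a′ eq = openers-decrease a a′ j<j′ d≤2
      where
      j<j′ : toℕ j < toℕ j′
      j<j′ = subst (toℕ j <_) (sym eq) (ℕ.m<n⇒m<1+n ℕ.≤-refl)

      d≤2 : toℕ j′ ∸ toℕ j ≤ 2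
      d≤2 rewrite eq | ℕ.m+n∸n≡m 2 (toℕ j) = s≤s (s≤s z≤n)

    ¬ArcAt-adjacent : ∀ {a a′ b} → ArcAt π a b → ¬ ArcAt π a′ (suc b)
    ¬ArcAt-adjacent x x′ with ArcAt⁻ π x | ArcAt⁻ π x′
    ... | _ , _ , a , refl , refl | _ , _ , a′ , _ , eq = ¬adjacent a a′ eq

    ¬ArcAt-crossing : ∀ {a a′ b} → ArcAt π a b → ArcAt π a′ (suc (suc b)) → a′ ≤ b → a′ < a
    ¬ArcAt-crossing x x′ with ArcAt⁻ π x | ArcAt⁻ π x′
    ... | _ , _ , a , refl , refl | _ , _ , a′ , refl , eq = crossing a a′ eq

  Matching⇒Scan : ∃₂ λ p c → ∃₂ λ av as → Scan (p ∷ c) m av as × Encodes π as × length as ≡ k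
  Matching⇒Scan
    with p , c , av , as , s , snd , cmp ← scanArcs (ArcAt π) (arcEndingAt? π) ArcAt⇒<
           ArcAt-unique ¬ArcAt-adjacent ¬ArcAt-crossing m ¬ArcAt-m =
    p , c , av , as , s , enc ,
    trans (sym (numArcs≡length π isPartialMatching s enc)) numArcs≡k
    where
    enc : Encodes π as
    enc = encodes (λ ij∈ → IsArc-toℕ (snd ij∈)) (λ {_} {j} a → cmp (arc a) (Fin.toℕ<n j))

-- The bijection

open RestrictedMatching using (partition; isPartialMatching)
open RestrictedSequence using (seq)

private variable
  k r : ℕ
  zs zs′ : List ℕ

-- `Codes zs M`: the word 0 ∷ zs is the code of the matching M.
record Codes (zs : List ℕ) (M : RestrictedMatching m k) : Set where
  constructor coded
  field
    {singletons} : List ℕ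
    {arcs}       : Arcs
    scan         : Scan (zs ʳ++ 0 ∷ []) m singletons arcs
    encoding     : Encodes (partition M) arcs

-- The set of blocks determines the set of arcs, and this determines the code. Hence the map to
-- sequences respects the equality of `𝒫`.
Codes-functional : {M M′ : RestrictedMatching m k} → Setoid._≈_ (𝒫 m k) M M′ →
                   Codes zs M → Codes zs′ M′ → zs ≡ zs′
Codes-functional M≈M′ (coded s enc) (coded s′ enc′) =
  -- By definition, `zs ʳ++ 0 ∷ []` is the reversal of `0 ∷ zs`.
  List.∷-injectiveʳ (List.reverse-injective (proj₁ (arcs⇒code s s′
    (blocks⊆⇒arcs⊆ s enc enc′ (Equivalence.to M≈M′))
    (blocks⊆⇒arcs⊆ s′ enc′ enc (Equivalence.from M≈M′)))))

Codes-injective : {M M′ : RestrictedMatching m k} → Codes zs M → Codes zs M′ →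
                  Setoid._≈_ (𝒫 m k) M M′
Codes-injective {M = M} {M′} (coded s enc) (coded s′ enc′)
  with _ , _ , refl ← code⇒arcs s s′ refl =
  mk⇔ (Encodes⇒⊆ (isPartialMatching M) (isPartialMatching M′) enc enc′)
      (Encodes⇒⊆ (isPartialMatching M′) (isPartialMatching M) enc′ enc)

-- Each unit contributes its X, and each arc one more point, its closer. So r units and k arcs fill
-- r + k points.
code-size : ∀ {av as} → Scan (zs ʳ++ 0 ∷ []) m av as → m ≡ length zs + length as
code-size {zs} {m} {av} {as} s = begin
  m                                   ≡⟨ scan-size s ⟩
  length as + length as + length av   ≡⟨ ℕ.+-assoc (length as) _ _ ⟩
  length as + (length as + length av) ≡⟨ cong (λ l → length as + l) len ⟨
  length as + length zs               ≡⟨ ℕ.+-comm (length as) _ ⟩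
  length zs + length as               ∎
  where
  open ≡-Reasoning

  len : length zs ≡ length as + length av
  len = ℕ.suc-injective (trans (ℕ.+-comm 1 (length zs))
    (trans (sym (List.length-ʳ++ zs)) (code-length s)))

code : (M : RestrictedMatching (r + k) k) →
       ∃[ zs ] Codes zs M × Word 0 0 zs k × length zs ≡ r
code {r} {k} M with _ , _ , av , as , s , enc , refl ← Matching⇒Scan M
  with zs , w , eq ← Scan⇒Word s [] =
  zs , coded s′ enc , subst (Word 0 0 zs) (ℕ.+-identityʳ _) w ,
  sym (ℕ.+-cancelʳ-≡ k r (length zs) (code-size {zs} s′))
  where
  s′ : Scan (zs ʳ++ 0 ∷ []) (r + k) av as
  s′ = subst (λ c → Scan c _ av as) (sym eq) s

-- The k letters that are not new maxima become arcs, and `code-size` then gives the number of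
-- points.
decode : Word 0 0 zs k → length zs ≡ r → ∃ (Codes {r + k} {k} zs)
decode {zs} w refl with Word⇒Scan start w
... | m , av , as , s , eq
  with refl ← trans eq (ℕ.+-identityʳ _) with refl ← code-size {zs} s =
  let M , enc = Scan⇒Matching s in M , coded s enc

toList≡⇒≡ : ∀ {n} {x y : Vec ℤ n} → toList x ≡ toList y → x ≡ y
toList≡⇒≡ {x = x} {y} eq = trans (sym (Vec.cast-is-id refl x)) (Vec.toList-injective refl x y eq)

theorem2p2 : (n k : ℕ) → 1 ≤ n → k ≤ n ∸ 1 →
    Bijection (𝒫 (n + k ∸ 1) k) (𝒮 n k)
-- For n = r + 1 the number of points n + k - 1 computes to r + k, and r is the number of units.
theorem2p2 (suc r) k _ k≤r = record
  { to        = to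
  ; cong      = λ {M} {M′} M≈M′ → toList≡⇒≡ (trans (to-code M)
      (trans (cong (λ zs → map +_ (0 ∷ zs)) (Codes-functional M≈M′ (codes M) (codes M′)))
             (sym (to-code M′))))
  ; bijective = (λ {M} {M′} → injective M M′) ,
                λ x → Product.map₂ (λ h {M} → h M) (surjective x)
  }
  where
  word : RestrictedMatching (r + k) k → List ℕ
  word M = proj₁ (code {r} M)

  codes : ∀ M → Codes (word M) M
  codes M = proj₁ (proj₂ (code {r} M))

  sequence : ∀ M → ∃[ x ] toList (seq {suc r} {k} x) ≡ map +_ (0 ∷ word M)
  sequence M = let _ , _ , w , len = code {r} M in Word⇒Sequence w len

  to : RestrictedMatching (r + k) k → RestrictedSequence (suc r) k
  to M = proj₁ (sequence M)

  to-code : ∀ M → toList (seq (to M)) ≡ map +_ (0 ∷ word M)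
  to-code M = proj₂ (sequence M)

  word-injective : ∀ {zs zs′} → map +_ (0 ∷ zs) ≡ map +_ (0 ∷ zs′) → zs ≡ zs′
  word-injective = List.∷-injectiveʳ ∘ List.map-injective ℤ.+-injective

  injective : ∀ M M′ → seq (to M) ≡ seq (to M′) → Setoid._≈_ (𝒫 (r + k) k) M M′
  injective M M′ eq = Codes-injective (codes M)
    (subst (λ zs → Codes zs M′) (sym word≡) (codes M′))
    where
    word≡ : word M ≡ word M′
    word≡ = word-injective (trans (sym (to-code M)) (trans (cong toList eq) (to-code M′)))

  length≡ : ∀ x zs → toList (seq {suc r} {k} x) ≡ map +_ (0 ∷ zs) → length zs ≡ r
  length≡ x zs eq = ℕ.suc-injective (trans (sym (List.length-map +_ (0 ∷ zs)))
    (trans (cong length (sym eq)) (Vec.length-toList (seq x))))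

  surjective : ∀ x → ∃[ M ] (∀ M′ → Setoid._≈_ (𝒫 (r + k) k) M′ M → seq (to M′) ≡ seq x)
  surjective x with zs , eq , w ← Sequence⇒Word k≤r x
    with M , codesM ← decode {r = r} w (length≡ x zs eq) =
    -- Every M′ equivalent to M has the code `0 ∷ zs` too, and therefore the sequence x.
    M , λ M′ M′≈M → toList≡⇒≡ (trans (to-code M′)
      (trans (cong (λ zs → map +_ (0 ∷ zs)) (Codes-functional M′≈M (codes M′) codesM))
             (sym eq)))
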